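{- Let $G$ be a finite almost simple group, let $K$ be a $2$-closed group with $G^*\le K\le\mathrm{Sym}(G)$, and let $\mathfrak U,\mathfrak L$ be the partitions associated with the principal $K$-section of $G$. Then the orbits of $K_{\mathfrak L}$ on $G\times G$ (componentwise action) are exactly the orbits contained in $Y\times Y$ for some $Y\in\mathfrak U$ together with all sets $\Delta\times\Delta'$ where $\Delta,\Delta'$ are orbits of $K_{\mathfrak L}$ on $G$ lying in distinct blocks of $\mathfrak U$ (i.e. the coherent configuration of orbits of $K_{\mathfrak L}$ is the direct sum of its restrictions to the blocks $Y\in\mathfrak U$). In particular $K_{\mathfrak L}=\prod_{Y\in\mathfrak U}(K_{\mathfrak L})^Y$, so $K$ is a generalized wreath product.
   Context: $G$ is almost simple if $\mathrm{soc}(G)$ is a nonabelian simple group. For $L\le G$, $L_{left}$, $L_{right}$ are the groups of permutations $g\mapsto xg$, $g\mapsto gx$ ($x\in L$) of $G$, and $L^*=L_{left}L_{right}$. $K$ is $2$-closed if every permutation preserving each orbit of $K$ on $G\times G$ lies in $K$. For an imprimitivity system $\mathfrak L$ of $K$, $K_{\mathfrak L}$ is the subgroup of $K$ fixing each block of $\mathfrak L$ setwise; for a union $Z$ of blocks, $(K_{\mathfrak L})^Z$ is the group induced by $K_{\mathfrak L}$ on $Z$; $\prod_{Y\in\mathfrak U}(K_{\mathfrak L})^Y$ denotes the group of all permutations whose restriction to each $Y$ lies in $(K_{\mathfrak L})^Y$. Principal section: the minimal block $L$ of $K$ is the intersection of all blocks of imprimitivity of $K$ that contain $1\in G$ and have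 more than one element (it is a $K$-block and a normal subgroup of $G$); $\mathfrak L$ is the imprimitivity system of $K$ containing $L$ (its blocks are the cosets of $L$). For $X,X'\in\mathfrak L$ write $X\sim X'$ if both restriction homomorphisms $(K_{\mathfrak L})^{X\cup X'}\to(K_{\mathfrak L})^X$ and $(K_{\mathfrak L})^{X\cup X'}\to(K_{\mathfrak L})^{X'}$ are isomorphisms; this is an equivalence relation. $U$ is the union of the $\sim$-class of $L$; it is a $K$-block and a normal subgroup with $L\trianglelefteq U\trianglelefteq G$, and $\mathfrak U$ is the imprimitivity system of $K$ containing $U$. $U/L$ is called the principal $K$-section of $G$ and $\mathfrak U,\mathfrak L$ the associated partitions. A generalized wreath product is a transitive group $K$ with imprimitivity systems $\mathfrak L,\mathfrak U$, each block of $\mathfrak L$ inside a block of $\mathfrak U$, and $K_{\mathfrak L}=\prod_{Y\in\mathfrak U}(K_{\mathfrak L})^Y$. -}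

module Defs where

open import Level using (Level; _⊔_) renaming (suc to lsuc; zero to 0ℓ)
open import Data.Nat using (ℕ)
open import Data.Fin using (Fin)
open import Data.Fin.Permutation using (Permutation′; _⟨$⟩ʳ_; _⟨$⟩ˡ_; _∘ₚ_; flip)
  renaming (id to idₚ)
open import Data.Product using (Σ; ∃; ∃₂; _×_; _,_)
open import Data.Sum using (_⊎_)
open import Relation.Binary.PropositionalEquality using (_≡_; _≢_)
open import Relation.Nullary using (¬_)

record FinGroup (n : ℕ) : Set where
  infixl 7 _·_
  field
    _·_   : Fin n → Fin n → Fin n
    e     : Fin n
    _⁻¹   : Fin n → Fin n
    assoc : ∀ x y z → (x · y) · z ≡ x · (y · z)
    idˡ   : ∀ x → e · x ≡ x
    idʳ   : ∀ x → x · e ≡ x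
    invˡ  : ∀ x → (x ⁻¹) · x ≡ e
    invʳ  : ∀ x → x · (x ⁻¹) ≡ e

module GroupNotions {n : ℕ} (G : FinGroup n) where
  open FinGroup G

  IsSubgroup : ∀ {ℓ} → (Fin n → Set ℓ) → Set ℓ
  IsSubgroup H = H e × (∀ x y → H x → H y → H (x · y)) × (∀ x → H x → H (x ⁻¹))

  IsNormal : ∀ {ℓ} → (Fin n → Set ℓ) → Set ℓ
  IsNormal H = ∀ g h → H h → H ((g · h) · (g ⁻¹))

  IsTrivial : ∀ {ℓ} → (Fin n → Set ℓ) → Set ℓ
  IsTrivial H = ∀ x → H x → x ≡ e

  IsNontrivial : ∀ {ℓ} → (Fin n → Set ℓ) → Set ℓ
  IsNontrivial H = ∃ λ x → H x × x ≢ e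

  IsMinimalNormal : (Fin n → Set) → Set₁
  IsMinimalNormal N =
    IsSubgroup N × IsNormal N × IsNontrivial N ×
    ((M : Fin n → Set) → IsSubgroup M → IsNormal M → (∀ x → M x → N x) →
       IsTrivial M ⊎ (∀ x → N x → M x))

  data Generated {ℓ} (P : Fin n → Set ℓ) : Fin n → Set ℓ where
    gen     : ∀ {x} → P x → Generated P x
    gen-e   : Generated P e
    gen-mul : ∀ {x y} → Generated P x → Generated P y → Generated P (x · y)
    gen-inv : ∀ {x} → Generated P x → Generated P (x ⁻¹)

  Socle : Fin n → Set₁
  Socle = Generated (λ x → Σ (Fin n → Set) λ N → IsMinimalNormal N × N x)

  IsNonabelianSimple : ∀ {ℓ} → (Fin n → Set ℓ) → Set (lsuc 0ℓ ⊔ ℓ)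
  IsNonabelianSimple S =
    (∃₂ λ x y → S x × S y × (x · y ≢ y · x)) × IsNontrivial S ×
    ((H : Fin n → Set) → IsSubgroup H → (∀ x → H x → S x) →
       (∀ s h → S s → H h → H ((s · h) · (s ⁻¹))) →
       IsTrivial H ⊎ (∀ x → S x → H x))

  AlmostSimple : Set₁
  AlmostSimple = IsNonabelianSimple Socle

record PermGroup (n : ℕ) : Set₁ where
  field
    mem      : Permutation′ n → Set
    mem-resp : ∀ {σ τ} → (∀ i → σ ⟨$⟩ʳ i ≡ τ ⟨$⟩ʳ i) → mem σ → mem τ
    mem-id   : mem idₚ
    mem-∘    : ∀ {σ τ} → mem σ → mem τ → mem (σ ∘ₚ τ)
    mem-inv  : ∀ {σ} → mem σ → mem (flip σ)

ContainsGStar : ∀ {n} → FinGroup n → PermGroup n → Set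
ContainsGStar G K =
  ∀ x y → ∃ λ σ → PermGroup.mem K σ × (∀ g → σ ⟨$⟩ʳ g ≡ (x · g) · y)
  where open FinGroup G

SameOrbit₂ : ∀ {n ℓ} → (Permutation′ n → Set ℓ) → Fin n → Fin n → Fin n → Fin n → Set ℓ
SameOrbit₂ P a b c d = ∃ λ σ → P σ × σ ⟨$⟩ʳ a ≡ c × σ ⟨$⟩ʳ b ≡ d

SameOrbit : ∀ {n ℓ} → (Permutation′ n → Set ℓ) → Fin n → Fin n → Set ℓ
SameOrbit P a c = ∃ λ σ → P σ × σ ⟨$⟩ʳ a ≡ c

TwoClosed : ∀ {n} → PermGroup n → Set
TwoClosed {n} K =
  ∀ σ → (∀ a b → SameOrbit₂ (PermGroup.mem K) a b (σ ⟨$⟩ʳ a) (σ ⟨$⟩ʳ b)) → PermGroup.mem K σ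

module PrincipalSection {n : ℕ} (G : FinGroup n) (K : PermGroup n) where
  open FinGroup G
  open PermGroup K

  IsBlock : (Fin n → Set) → Set
  IsBlock B = ∀ σ → mem σ →
    (∀ x → (B x → B (σ ⟨$⟩ʳ x)) × (B (σ ⟨$⟩ʳ x) → B x)) ⊎ (∀ x → B x → ¬ B (σ ⟨$⟩ʳ x))

  L : Fin n → Set₁
  L x = (B : Fin n → Set) → IsBlock B → B e → (∃₂ λ a b → B a × B b × a ≢ b) → B x

  -- the blocks of 𝔏 are the images τL (τ ∈ K); x ∈ τL iff τ⁻¹x ∈ L
  InLBlock : Permutation′ n → Fin n → Set₁
  InLBlock τ x = L (τ ⟨$⟩ˡ x)

  KL : Permutation′ n → Set₁
  KL σ = mem σ × (∀ τ → mem τ → ∀ x → (InLBlock τ x → InLBlock τ (σ ⟨$⟩ʳ x)) ×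
                                        (InLBlock τ (σ ⟨$⟩ʳ x) → InLBlock τ x))

  -- the restriction map (K_𝔏)^{X ∪ X'} → (K_𝔏)^X is injective
  RestrictInj : Permutation′ n → Permutation′ n → Set₁
  RestrictInj τ τ' = ∀ σ ρ → KL σ → KL ρ →
    (∀ x → InLBlock τ x → σ ⟨$⟩ʳ x ≡ ρ ⟨$⟩ʳ x) →
    (∀ x → InLBlock τ' x → σ ⟨$⟩ʳ x ≡ ρ ⟨$⟩ʳ x)

  -- X ∼ X' (both restriction homomorphisms are isomorphisms)
  Sim : Permutation′ n → Permutation′ n → Set₁
  Sim τ τ' = RestrictInj τ τ' × RestrictInj τ' τ

  U : Fin n → Set₁
  U x = ∃ λ τ → mem τ × InLBlock τ x × Sim τ idₚ

  -- blocks of 𝔘 are the images τU (τ ∈ K)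
  InUBlock : Permutation′ n → Fin n → Set₁
  InUBlock τ x = U (τ ⟨$⟩ˡ x)

  SameU : Fin n → Fin n → Set₁
  SameU a b = ∃ λ τ → mem τ × InUBlock τ a × InUBlock τ b

  InProduct : Permutation′ n → Set₁
  InProduct σ = ∀ τ → mem τ →
    ∃ λ ρ → KL ρ × (∀ x → InUBlock τ x → σ ⟨$⟩ʳ x ≡ ρ ⟨$⟩ʳ x)

  Conclusion : Set₁
  Conclusion =
    (∀ a b → SameU a b → ∀ c d → SameOrbit₂ KL a b c d →
       ∃ λ τ → mem τ × InUBlock τ a × InUBlock τ b × InUBlock τ c × InUBlock τ d) ×
    (∀ a b → ¬ SameU a b → ∀ c d →
       (SameOrbit₂ KL a b c d → SameOrbit KL a c × SameOrbit KL b d) ×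
       (SameOrbit KL a c × SameOrbit KL b d → SameOrbit₂ KL a b c d)) ×
    -- K is a generalized wreath product w.r.t. 𝔏, 𝔘
    (∀ τ → mem τ → ∃ λ τ' → mem τ' × (∀ x → InLBlock τ x → InUBlock τ' x)) ×
    (∀ σ → (KL σ → InProduct σ) × (InProduct σ → KL σ))

{-# OPTIONS --safe #-}
-- Every nontrivial block of K_𝔏 inside L containing 1 is a subgroup normalized by L, hence
-- contains the socle; so the minimal such block is nontrivial, and as K_𝔏 is normal in K it
-- is a block of K, hence equal to L: K_𝔏 acts primitively on each class of 𝔏.
-- If X ≁ X', one of the two pointwise stabilizers in K_𝔏, say that of X, acts nontrivially
-- on X'.  Being normal in K_𝔏, it is transitive on X', so orbits in X and X' can be matched
-- independently, and 2-closedness recovers K_𝔏 as a product.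
-- The argument is classical, but simplicity of the socle quantifies over arbitrary
-- predicates and thereby yields excluded middle for Set.
module Submission where

open import Defs
open import Data.Nat using (ℕ)
open import Algebra.Bundles using (Group)
import Algebra.Properties.Group as GroupProperties
open import Axiom.ExcludedMiddle using (ExcludedMiddle)
open import Data.Empty using (⊥-elim)
open import Data.Fin using (Fin)
open import Data.Fin.Permutation
  using (Permutation′; _⟨$⟩ʳ_; _⟨$⟩ˡ_; _∘ₚ_; flip; inverseˡ; inverseʳ)
  renaming (id to idₚ)
open import Data.Fin.Properties using (_≟_)
open import Data.Fin.Subset using (Subset; _∈_; _⊂_)
open import Data.Fin.Subset.Induction using (⊂-wellFounded)
open import Data.Product using (∃; ∃₂; _×_; _,_; proj₁; proj₂)
open import Data.Sum using (_⊎_; inj₁; inj₂)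
open import Data.Unit using (⊤; tt)
open import Data.Vec using (tabulate)
open import Data.Vec.Properties using (lookup∘tabulate; lookup⇒[]=; []=⇒lookup)
open import Function using (_∘_; _⇔_; mk⇔; Equivalence)
open import Induction.WellFounded using (Acc; acc)
open import Level using (0ℓ)
open import Relation.Binary.PropositionalEquality
open import Relation.Nullary using (¬_; yes; no; does; contradiction)
open import Relation.Nullary.Decidable using (dec-true; decidable-stable)

-- Predicates as finite subsets.

module _ {n : ℕ} (em : ExcludedMiddle 0ℓ) (P : Fin n → Set) where

  comprehension : Subset n
  comprehension = tabulate λ x → does (em {P x})

  ∈-comprehension⁺ : ∀ {x} → P x → x ∈ comprehension
  ∈-comprehension⁺ {x} px =
    lookup⇒[]= x _ (trans (lookup∘tabulate _ x) (dec-true em px))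

  ∈-comprehension⁻ : ∀ {x} → x ∈ comprehension → P x
  ∈-comprehension⁻ {x} x∈ with em {P x} | trans (sym (lookup∘tabulate (λ y → does (em {P y})) x)) ([]=⇒lookup x∈)
  ... | yes px | _ = px

-- Minimal normal subgroups and the simple socle.

module SimpleSocle {n : ℕ} (G : FinGroup n) where
  open FinGroup G
  open GroupNotions G

  group : Group 0ℓ 0ℓ
  group = record
    { _≈_ = _≡_ ; _∙_ = _·_ ; ε = e ; _⁻¹ = _⁻¹
    ; isGroup = record
      { isMonoid = record
        { isSemigroup = record
          { isMagma = record { isEquivalence = isEquivalence ; ∙-cong = cong₂ _·_ }
          ; assoc = assoc }
        ; identity = idˡ , idʳ }
      ; inverse = invˡ , invʳ
      ; ⁻¹-cong = cong _⁻¹ } }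

  open GroupProperties group public
    using (\\-leftDividesʳ; //-rightDividesˡ; //-rightDividesʳ; x∙y⁻¹≈ε⇒x≈y; ⁻¹-involutive)

  conj : Fin n → Fin n → Fin n
  conj g x = (g · x) · (g ⁻¹)

  conj-· : ∀ g x y → conj g (x · y) ≡ conj g x · conj g y
  conj-· g x y = begin
    (g · (x · y)) · (g ⁻¹)                ≡⟨ cong (_· (g ⁻¹)) (assoc g x y) ⟨
    ((g · x) · y) · (g ⁻¹)                ≡⟨ assoc _ _ _ ⟩
    (g · x) · (y · (g ⁻¹))                ≡⟨ cong (_· (y · (g ⁻¹))) (//-rightDividesˡ g (g · x)) ⟨
    (conj g x · g) · (y · (g ⁻¹))         ≡⟨ assoc _ _ _ ⟩
    conj g x · (g · (y · (g ⁻¹)))         ≡⟨ cong (conj g x ·_) (assoc g y (g ⁻¹)) ⟨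
    conj g x · conj g y                   ∎
    where open ≡-Reasoning

  conj-conj⁻¹ : ∀ g x → conj g (conj (g ⁻¹) x) ≡ x
  conj-conj⁻¹ g x = begin
    (g · (((g ⁻¹) · x) · ((g ⁻¹) ⁻¹))) · (g ⁻¹) ≡⟨ cong (λ h → (g · (((g ⁻¹) · x) · h)) · (g ⁻¹)) (⁻¹-involutive g) ⟩
    (g · (((g ⁻¹) · x) · g)) · (g ⁻¹)           ≡⟨ cong (_· (g ⁻¹)) (assoc g _ g) ⟨
    ((g · ((g ⁻¹) · x)) · g) · (g ⁻¹)           ≡⟨ //-rightDividesʳ g _ ⟩
    g · ((g ⁻¹) · x)                            ≡⟨ assoc g _ x ⟨
    (g · (g ⁻¹)) · x                            ≡⟨ cong (_· x) (invʳ g) ⟩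
    e · x                                       ≡⟨ idˡ x ⟩
    x                                           ∎
    where open ≡-Reasoning

  -- The argument is constructive, since excluded middle is extracted later from the minimal normal
  -- subgroup found here. A derivation of socle membership without generators produces only `e`.
  Socle-generator : ∀ {x} → Socle x → x ≢ e → ∃ IsMinimalNormal
  Socle-generator {x} x∈S x≢e with go x∈S
    where
    go : ∀ {x} → Socle x → x ≡ e ⊎ ∃ IsMinimalNormal
    go (gen (N , minN , _)) = inj₂ (N , minN)
    go gen-e = inj₁ refl
    go (gen-mul x∈S y∈S) with go x∈S | go y∈S
    ... | inj₂ N    | _         = inj₂ N
    ... | inj₁ _    | inj₂ N    = inj₂ N
    ... | inj₁ refl | inj₁ refl = inj₁ (idˡ e)
    go (gen-inv x∈S) with go x∈S
    ... | inj₂ N    = inj₂ N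
    ... | inj₁ refl = inj₁ (trans (sym (idˡ _)) (invʳ e))
  ... | inj₁ x≡e = contradiction x≡e x≢e
  ... | inj₂ N   = N

  -- Minimality of N applied to the subgroup {x ∈ N ∣ x ≡ e or P} decides P.
  minimalNormal⇒em : ∀ {N} → IsMinimalNormal N → ExcludedMiddle 0ℓ
  minimalNormal⇒em {N} ((Ne , N· , N⁻¹) , normal , (a , Na , a≢e) , minimal) {P}
    with minimal M (inj₁ refl , M· , M⁻¹) M-normal M⊆N
    where
    M : Fin n → Set
    M x = x ≡ e ⊎ (P × N x)
    M⊆N : ∀ x → M x → N x
    M⊆N _ (inj₁ refl)     = Ne
    M⊆N _ (inj₂ (_ , Nx)) = Nx
    M· : ∀ x y → M x → M y → M (x · y)
    M· x y (inj₂ (p , Nx)) My = inj₂ (p , N· x y Nx (M⊆N y My))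
    M· _ y (inj₁ refl)     My = subst M (sym (idˡ y)) My
    M⁻¹ : ∀ x → M x → M (x ⁻¹)
    M⁻¹ x (inj₂ (p , Nx)) = inj₂ (p , N⁻¹ x Nx)
    M⁻¹ _ (inj₁ refl)     = inj₁ (trans (sym (idˡ _)) (invʳ e))
    M-normal : IsNormal M
    M-normal g h (inj₂ (p , Nh)) = inj₂ (p , normal g h Nh)
    M-normal g _ (inj₁ refl)     = inj₁ (trans (cong (_· (g ⁻¹)) (idʳ g)) (invʳ g))
  ... | inj₁ trivial = no λ p → a≢e (trivial a (inj₂ (p , Na)))
  ... | inj₂ N⊆M with N⊆M a Na
  ...   | inj₁ a≡e     = contradiction a≡e a≢e
  ...   | inj₂ (p , _) = yes p

  IsNontrivialNormal : (Fin n → Set) → Set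
  IsNontrivialNormal H = IsSubgroup H × IsNormal H × IsNontrivial H

  module _ (em : ExcludedMiddle 0ℓ) where

    comprehension-nontrivialNormal : ∀ {H} → IsNontrivialNormal H →
      IsNontrivialNormal (_∈ comprehension em H)
    comprehension-nontrivialNormal {H} ((He , H· , H⁻¹) , normal , (a , Ha , a≢e)) =
      (⁺ He , (λ x y x∈ y∈ → ⁺ (H· x y (⁻ x∈) (⁻ y∈))) , (λ x x∈ → ⁺ (H⁻¹ x (⁻ x∈)))) ,
      (λ g h h∈ → ⁺ (normal g h (⁻ h∈))) , a , ⁺ Ha , a≢e
      where
      ⁺ : ∀ {x} → H x → x ∈ comprehension em H
      ⁺ = ∈-comprehension⁺ em H
      ⁻ : ∀ {x} → x ∈ comprehension em H → H x
      ⁻ = ∈-comprehension⁻ em H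

    -- Well-founded descent along `_⊂_`; passing to `comprehension` makes this order available for
    -- arbitrary predicates.
    minimalNormal-below : ∀ {H} → IsNontrivialNormal H →
      ∃ λ M → IsMinimalNormal M × (∀ {x} → M x → H x)
    minimalNormal-below {H} nnH =
      let M , minM , M⊆ = go _ (⊂-wellFounded _) (comprehension-nontrivialNormal nnH)
      in M , minM , λ Mx → ∈-comprehension⁻ em H (M⊆ Mx)
      where
      go : ∀ s → Acc _⊂_ s → IsNontrivialNormal (_∈ s) →
           ∃ λ M → IsMinimalNormal M × (∀ {x} → M x → x ∈ s)
      go s (acc rec) nn@(sub , normal , nontrivial)
        with em {∃ λ t → t ⊂ s × IsNontrivialNormal (_∈ t)}
      ... | yes (t , t⊂s , nnt) =
        let M , minM , M⊆t = go t (rec t⊂s) nnt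
        in M , minM , λ Mx → proj₁ t⊂s (M⊆t Mx)
      ... | no none = (_∈ s) , (sub , normal , nontrivial , minimal) , λ x∈ → x∈
        where
        minimal : (M : Fin n → Set) → IsSubgroup M → IsNormal M → (∀ x → M x → x ∈ s) →
                  IsTrivial M ⊎ (∀ x → x ∈ s → M x)
        minimal M subM normalM M⊆s with em {IsNontrivial M}
        ... | no triv = inj₁ λ x Mx → decidable-stable (x ≟ e) λ x≢e → triv (x , Mx , x≢e)
        -- A point of `s` outside `M` would make `M` a strictly smaller nontrivial normal subgroup,
        -- against `none`.
        ... | yes nontrivialM = inj₂ λ x x∈s → decidable-stable em λ ¬Mx → none
          ( comprehension em M
          , ((λ {y} y∈ → M⊆s y (∈-comprehension⁻ em M y∈)) , x , x∈s , λ x∈ → ¬Mx (∈-comprehension⁻ em M x∈))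
          , comprehension-nontrivialNormal (subM , normalM , nontrivialM) )

  centralizer : (Fin n → Set) → Fin n → Set
  centralizer N z = ∀ s → N s → z · s ≡ s · z

  centralizer-subgroup : ∀ N → IsSubgroup (centralizer N)
  centralizer-subgroup N = (λ s _ → trans (idˡ s) (sym (idʳ s))) , C· , C⁻¹
    where
    open ≡-Reasoning
    C· : ∀ x y → centralizer N x → centralizer N y → centralizer N (x · y)
    C· x y Cx Cy s Ns = begin
      (x · y) · s ≡⟨ assoc x y s ⟩
      x · (y · s) ≡⟨ cong (x ·_) (Cy s Ns) ⟩
      x · (s · y) ≡⟨ assoc x s y ⟨
      (x · s) · y ≡⟨ cong (_· y) (Cx s Ns) ⟩
      (s · x) · y ≡⟨ assoc s x y ⟩
      s · (x · y) ∎
    C⁻¹ : ∀ x → centralizer N x → centralizer N (x ⁻¹)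
    C⁻¹ x Cx s Ns = begin
      (x ⁻¹) · s                      ≡⟨ cong ((x ⁻¹) ·_) (//-rightDividesʳ x s) ⟨
      (x ⁻¹) · ((s · x) · (x ⁻¹))     ≡⟨ cong (λ y → (x ⁻¹) · (y · (x ⁻¹))) (Cx s Ns) ⟨
      (x ⁻¹) · ((x · s) · (x ⁻¹))     ≡⟨ cong ((x ⁻¹) ·_) (assoc x s (x ⁻¹)) ⟩
      (x ⁻¹) · (x · (s · (x ⁻¹)))     ≡⟨ \\-leftDividesʳ x _ ⟩
      s · (x ⁻¹)                      ∎

  centralizer-normal : ∀ {N} → IsNormal N → IsNormal (centralizer N)
  centralizer-normal normal g z Cz s Ns =
    subst (λ t → conj g z · t ≡ t · conj g z) (conj-conj⁻¹ g s) (begin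
      conj g z · conj g s′ ≡⟨ conj-· g z s′ ⟨
      conj g (z · s′)      ≡⟨ cong (conj g) (Cz s′ (normal (g ⁻¹) s Ns)) ⟩
      conj g (s′ · z)      ≡⟨ conj-· g s′ z ⟩
      conj g s′ · conj g z ∎)
    where
    open ≡-Reasoning
    s′ : Fin n
    s′ = conj (g ⁻¹) s

  module _ (almostSimple : AlmostSimple) where
    private
      noncommuting : ∃₂ λ x y → Socle x × Socle y × (x · y ≢ y · x)
      noncommuting = proj₁ almostSimple

    minimalNormal : ∃ IsMinimalNormal
    minimalNormal with proj₁ (proj₂ almostSimple)
    ... | _ , x∈S , x≢e = Socle-generator x∈S x≢e

    -- `N` is a nontrivial normal subgroup of the socle, so simplicity leaves no room between them.
    Socle⊆minimalNormal : ∀ {N} → IsMinimalNormal N → ∀ {x} → Socle x → N x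
    Socle⊆minimalNormal {N} minN@(sub , normal , (a , Na , a≢e) , _) {x} x∈S
      with proj₂ (proj₂ almostSimple) N sub (λ _ Nx → gen (N , minN , Nx)) (λ s h _ → normal s h)
    ... | inj₁ trivial = contradiction (trivial a Na) a≢e
    ... | inj₂ S⊆N     = S⊆N x x∈S

    -- If B ∩ N = 1 then B centralizes N, so the socle, which lies below every
    -- nontrivial normal subgroup, lies in the centralizer of N and is abelian.
    normalizedSubgroup⊇minimalNormal : ∀ {N B} → IsMinimalNormal N → IsSubgroup B →
      (∀ s b → N s → B b → B (conj s b)) → IsNontrivial B → ∀ {s} → N s → B s
    normalizedSubgroup⊇minimalNormal {N} {B} minN@((Ne , N· , N⁻¹) , normalN , _) (Be , B· , B⁻¹) N-norm (b , Bb , b≢e) {s} Ns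
      with proj₂ (proj₂ almostSimple) (λ x → N x × B x)
             ((Ne , Be) , (λ x y (Nx , Bx) (Ny , By) → N· x y Nx Ny , B· x y Bx By) , (λ x (Nx , Bx) → N⁻¹ x Nx , B⁻¹ x Bx))
             (λ _ (Nx , _) → gen (N , minN , Nx))
             -- `B` is normalized by `N`, hence by the socle, which lies in `N`.
             (λ t h t∈S (Nh , Bh) → normalN t h Nh , N-norm t h (Socle⊆minimalNormal minN t∈S) Bh)
    ... | inj₂ S⊆B = proj₂ (S⊆B s (gen (N , minN , Ns)))
    ... | inj₁ trivial = ⊥-elim (xy≢yx (M⊆C (Socle⊆minimalNormal minM x∈S) y (Socle⊆minimalNormal minN y∈S)))
      where
      b∈C : centralizer N b
      b∈C t Nt = trans (sym (//-rightDividesˡ b (b · t))) (cong (_· b) (x∙y⁻¹≈ε⇒x≈y (conj b t) t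
        -- The commutator of `b` and `t` lies in `N` as `conj b t · (t ⁻¹)` and in `B` as
        -- `b · conj t (b ⁻¹)`.
        (trivial _ ( N· _ _ (normalN b t Nt) (N⁻¹ t Nt)
                   , subst B (sym rearrange) (B· _ _ Bb (N-norm t (b ⁻¹) Nt (B⁻¹ b Bb)))))))
        where
        open ≡-Reasoning
        rearrange : conj b t · (t ⁻¹) ≡ b · conj t (b ⁻¹)
        rearrange = begin
          ((b · t) · (b ⁻¹)) · (t ⁻¹) ≡⟨ cong (_· (t ⁻¹)) (assoc b t (b ⁻¹)) ⟩
          (b · (t · (b ⁻¹))) · (t ⁻¹) ≡⟨ assoc b _ (t ⁻¹) ⟩
          b · ((t · (b ⁻¹)) · (t ⁻¹)) ∎
      below : ∃ λ M → IsMinimalNormal M × (∀ {x} → M x → centralizer N x)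
      below = minimalNormal-below (minimalNormal⇒em minN)
                (centralizer-subgroup N , centralizer-normal normalN , b , b∈C , b≢e)
      minM : IsMinimalNormal (proj₁ below)
      minM = proj₁ (proj₂ below)
      M⊆C : ∀ {x} → proj₁ below x → centralizer N x
      M⊆C = proj₂ (proj₂ below)
      x y : Fin n
      x = proj₁ noncommuting
      y = proj₁ (proj₂ noncommuting)
      x∈S : Socle x
      x∈S = proj₁ (proj₂ (proj₂ noncommuting))
      y∈S : Socle y
      y∈S = proj₁ (proj₂ (proj₂ (proj₂ noncommuting)))
      xy≢yx : x · y ≢ y · x
      xy≢yx = proj₂ (proj₂ (proj₂ (proj₂ noncommuting)))

-- Minimal blocks of a permutation group.

-- As H is closed under inverses, this is the usual dichotomy σB = B or σB ∩ B = ∅.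
Block : ∀ {n} → PermGroup n → (Fin n → Set) → Set
Block H B = ∀ {σ x y} → PermGroup.mem H σ → B x → B (σ ⟨$⟩ʳ x) → B y → B (σ ⟨$⟩ʳ y)

Nontrivialₚ : ∀ {n} → (Fin n → Set) → Fin n → Set
Nontrivialₚ B p = ∃ λ q → B q × q ≢ p

-- The bound `C` accommodates intransitive groups: it is trivial for `K`, and a class of 𝔏 for `KL`,
-- so that only blocks inside that class are intersected.
MinBlock : ∀ {n} → PermGroup n → (Fin n → Set) → Fin n → Fin n → Set
MinBlock {n} H C p x = (B : Subset n) → Block H (_∈ B) → p ∈ B →
  Nontrivialₚ (_∈ B) p → (∀ {y} → y ∈ B → C y) → x ∈ B

module _ {n : ℕ} (H : PermGroup n) {C : Fin n → Set} {p : Fin n} where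

  MinBlock-block : Block H (MinBlock H C p)
  MinBlock-block σ∈H mx mσx my B blk p∈ nt B⊆C =
    blk σ∈H (mx B blk p∈ nt B⊆C) (mσx B blk p∈ nt B⊆C) (my B blk p∈ nt B⊆C)

  MinBlock-refl : MinBlock H C p p
  MinBlock-refl B blk p∈ nt B⊆C = p∈

  -- Excluded middle turns the predicate `B` into one of the subsets being intersected.
  MinBlock-least : ExcludedMiddle 0ℓ → {B : Fin n → Set} → Block H B → B p →
    Nontrivialₚ B p → (∀ {y} → B y → C y) → ∀ {x} → MinBlock H C p x → B x
  MinBlock-least em {B} blk Bp (q , Bq , q≢p) B⊆C mx =
    ⁻ (mx (comprehension em B) (λ σ∈H x∈ σx∈ y∈ → ⁺ (blk σ∈H (⁻ x∈) (⁻ σx∈) (⁻ y∈)))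
          (⁺ Bp) (q , ⁺ Bq , q≢p) (B⊆C ∘ ⁻))
    where
    ⁺ : ∀ {x} → B x → x ∈ comprehension em B
    ⁺ = ∈-comprehension⁺ em B
    ⁻ : ∀ {x} → x ∈ comprehension em B → B x
    ⁻ = ∈-comprehension⁻ em B

-- The group `K`, its translations, and blocks containing the identity.

module GeneralizedWreath {n : ℕ} (G : FinGroup n) (K : PermGroup n)
  (almostSimple : GroupNotions.AlmostSimple G) (G*≤K : ContainsGStar G K) (closed : TwoClosed K) where

  open FinGroup G
  open GroupNotions G
  open SimpleSocle G
  open PermGroup K
  private module P = PrincipalSection G K

  N : Fin n → Set
  N = proj₁ (minimalNormal almostSimple)

  N-minimal : IsMinimalNormal N
  N-minimal = proj₂ (minimalNormal almostSimple)

  em : ExcludedMiddle 0ℓ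
  em = minimalNormal⇒em N-minimal

  left-translation : ∀ b → ∃ λ σ → mem σ × (∀ g → σ ⟨$⟩ʳ g ≡ b · g)
  left-translation b = let σ , σ∈K , eq = G*≤K b e in σ , σ∈K , λ g → trans (eq g) (idʳ _)

  right-translation : ∀ b → ∃ λ σ → mem σ × (∀ g → σ ⟨$⟩ʳ g ≡ g · b)
  right-translation b =
    let σ , σ∈K , eq = G*≤K e b in σ , σ∈K , λ g → trans (eq g) (cong (_· b) (idˡ g))

  transitive : ∀ x → ∃ λ σ → mem σ × σ ⟨$⟩ʳ e ≡ x
  transitive x = let σ , σ∈K , eq = right-translation x in σ , σ∈K , trans (eq e) (idˡ x)

  -- Left translation by an element of `B` sends `e` into `B`, so it preserves `B`; with the inverse
  -- permutations this makes `B` a subgroup. Conjugation by an element of `N` fixes `e`, so it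
  -- preserves `B` too. Translations are requested only for elements of `B`, so that the lemma
  -- serves both `K` and `KL`.
  block⊇N : (H : PermGroup n) {B : Fin n → Set} → Block H B → B e → Nontrivialₚ B e →
    (∀ b → B b → ∃ λ σ → PermGroup.mem H σ × (∀ g → σ ⟨$⟩ʳ g ≡ b · g)) →
    (∀ s → N s → ∃ λ σ → PermGroup.mem H σ × (∀ g → σ ⟨$⟩ʳ g ≡ conj s g)) →
    ∀ {s} → N s → B s
  block⊇N H {B} blk Be nontrivial left conjugation =
    normalizedSubgroup⊇minimalNormal almostSimple N-minimal (Be , B· , B⁻¹) N-norm nontrivial
    where
    B· : ∀ x y → B x → B y → B (x · y)
    B· x y Bx By =
      let σ , σ∈H , eq = left x Bx
      in subst B (eq y) (blk σ∈H Be (subst B (sym (trans (eq e) (idʳ x))) Bx) By)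
    B⁻¹ : ∀ x → B x → B (x ⁻¹)
    B⁻¹ x Bx =
      let σ , σ∈H , eq = left x Bx
          σ⁻¹x≡e = trans (cong (σ ⟨$⟩ˡ_) (sym (trans (eq e) (idʳ x)))) (inverseˡ σ)
          σ⁻¹e≡x⁻¹ = trans (cong (σ ⟨$⟩ˡ_) (sym (trans (eq (x ⁻¹)) (invʳ x)))) (inverseˡ σ)
      in subst B σ⁻¹e≡x⁻¹ (blk (PermGroup.mem-inv H σ∈H) Bx (subst B (sym σ⁻¹x≡e) Be) Be)
    N-norm : ∀ s b → N s → B b → B (conj s b)
    N-norm s b Ns Bb =
      let σ , σ∈H , eq = conjugation s Ns
          σe≡e = trans (eq e) (trans (cong (_· (s ⁻¹)) (idʳ s)) (invʳ s))
      in subst B (eq b) (blk σ∈H Be (subst B (sym σe≡e) Be) Bb)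

  -- The minimal block of `K` and the partition 𝔏.

  -- P.L lives in Set₁; quantifying over subsets of Fin n gives an equivalent in Set.
  L : Fin n → Set
  L = MinBlock K (λ _ → ⊤) e

  N⊆L : ∀ {s} → N s → L s
  N⊆L Ns B blk e∈B nontrivial _ = block⊇N K blk e∈B nontrivial (λ b _ → left-translation b)
    (λ s _ → G*≤K s (s ⁻¹)) Ns

  -- The imprimitivity system 𝔏, as an equivalence relation.
  E : Fin n → Fin n → Set
  E x y = ∃ λ τ → mem τ × L (τ ⟨$⟩ˡ x) × L (τ ⟨$⟩ˡ y)

  E-refl : ∀ {x} → E x x
  E-refl {x} with transitive x
  ... | σ , σ∈K , refl = σ , σ∈K , Lσ⁻¹x , Lσ⁻¹x
    where
    Lσ⁻¹x : L (σ ⟨$⟩ˡ (σ ⟨$⟩ʳ e))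
    Lσ⁻¹x = subst L (sym (inverseˡ σ)) (MinBlock-refl K)

  E-sym : ∀ {x y} → E x y → E y x
  E-sym (τ , τ∈K , Lx , Ly) = τ , τ∈K , Ly , Lx

  -- `τ′ ∘ₚ flip τ` sends the preimage of `y` under `τ′`, a point of `L`, to the preimage of `y`
  -- under `τ`, again in `L`. Hence it preserves `L`, and in particular handles the preimage of `z`.
  E-trans : ∀ {x y z} → E x y → E y z → E x z
  E-trans {y = y} {z} (τ , τ∈K , Lx , Ly) (τ′ , τ′∈K , L′y , L′z) =
    τ , τ∈K , Lx , subst L (cong (τ ⟨$⟩ˡ_) (inverseʳ τ′))
      (MinBlock-block K (mem-∘ τ′∈K (mem-inv τ∈K)) L′y
        (subst L (cong (τ ⟨$⟩ˡ_) (sym (inverseʳ τ′))) Ly) L′z)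

  E-map : ∀ {σ x y} → mem σ → E x y → E (σ ⟨$⟩ʳ x) (σ ⟨$⟩ʳ y)
  E-map {σ} σ∈K (τ , τ∈K , Lx , Ly) = τ ∘ₚ σ , mem-∘ τ∈K σ∈K ,
    subst L (cong (τ ⟨$⟩ˡ_) (sym (inverseˡ σ))) Lx , subst L (cong (τ ⟨$⟩ˡ_) (sym (inverseˡ σ))) Ly

  L⇒E : ∀ {x} → L x → E e x
  -- Right translation by `e` acts as the identity, so the block τL is `L` itself.
  L⇒E {x} Lx = let τ , τ∈K , τg≡ge = right-translation e
                   τ⁻¹g≡g = λ g → trans (cong (τ ⟨$⟩ˡ_) (sym (trans (τg≡ge g) (idʳ g)))) (inverseˡ τ)
               in τ , τ∈K , subst L (sym (τ⁻¹g≡g e)) (MinBlock-refl K) , subst L (sym (τ⁻¹g≡g x)) Lx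

  E⇒τL : ∀ {τ x} → mem τ → E (τ ⟨$⟩ʳ e) x → L (τ ⟨$⟩ˡ x)
  E⇒τL {τ} τ∈K (τ′ , τ′∈K , L′τe , L′x) = subst L (cong (τ ⟨$⟩ˡ_) (inverseʳ τ′))
    (MinBlock-block K (mem-∘ τ′∈K (mem-inv τ∈K)) L′τe
      (subst L (sym (trans (cong (τ ⟨$⟩ˡ_) (inverseʳ τ′)) (inverseˡ τ))) (MinBlock-refl K)) L′x)

  τL⇒E : ∀ {τ x} → mem τ → L (τ ⟨$⟩ˡ x) → E (τ ⟨$⟩ʳ e) x
  τL⇒E {τ} τ∈K Lx = subst (E _) (inverseʳ τ) (E-map τ∈K (L⇒E Lx))

  E⇒L : ∀ {x} → E e x → L x
  E⇒L = E⇒τL mem-id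

  -- The group K_𝔏 and its transitivity on each class.

  KL : PermGroup n
  KL = record
    { mem      = λ σ → mem σ × (∀ x → E x (σ ⟨$⟩ʳ x))
    ; mem-resp = λ σ≈τ (σ∈K , σE) → mem-resp σ≈τ σ∈K , λ x → subst (E x) (σ≈τ x) (σE x)
    ; mem-id   = mem-id , λ _ → E-refl
    ; mem-∘    = λ (σ∈K , σE) (τ∈K , τE) → mem-∘ σ∈K τ∈K , λ x → E-trans (σE x) (τE _)
    ; mem-inv  = λ {σ} (σ∈K , σE) → mem-inv σ∈K , λ x → E-sym (subst (E _) (inverseʳ σ) (σE _))
    }

  open PermGroup KL using () renaming (mem to memL; mem-∘ to memL-∘; mem-inv to memL-inv)

  conjₚ : Permutation′ n → Permutation′ n → Permutation′ n
  conjₚ τ σ = flip τ ∘ₚ σ ∘ₚ τ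

  KL-normal : ∀ {τ σ} → mem τ → memL σ → memL (conjₚ τ σ)
  KL-normal {τ} {σ} τ∈K (σ∈K , σE) = mem-∘ (mem-inv τ∈K) (mem-∘ σ∈K τ∈K) ,
    λ x → subst (λ y → E y (conjₚ τ σ ⟨$⟩ʳ x)) (inverseʳ τ) (E-map τ∈K (σE (τ ⟨$⟩ˡ x)))

  -- The pair `(x , b · x)` is the image of `(e , b)` under right translation by `x`, and `E` is
  -- `K`-invariant. The mirror argument gives `KL-right`.
  KL-left : ∀ b → L b → ∃ λ σ → memL σ × (∀ g → σ ⟨$⟩ʳ g ≡ b · g)
  KL-left b Lb = let σ , σ∈K , eq = left-translation b in σ , (σ∈K , λ x →
    let ρ , ρ∈K , ρeq = right-translation x
    in subst₂ E (trans (ρeq e) (idˡ x)) (trans (ρeq b) (sym (eq x))) (E-map ρ∈K (L⇒E Lb))) , eq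

  KL-right : ∀ b → L b → ∃ λ σ → memL σ × (∀ g → σ ⟨$⟩ʳ g ≡ g · b)
  KL-right b Lb = let σ , σ∈K , eq = right-translation b in σ , (σ∈K , λ x →
    let ρ , ρ∈K , ρeq = left-translation x
    in subst₂ E (trans (ρeq e) (idʳ x)) (trans (ρeq b) (sym (eq x))) (E-map ρ∈K (L⇒E Lb))) , eq

  -- As `N` lies in `L`, both translations that compose to the conjugation are in `KL`; this lets
  -- `block⊇N` be applied to `KL`.
  KL-conj : ∀ s → N s → ∃ λ σ → memL σ × (∀ g → σ ⟨$⟩ʳ g ≡ conj s g)
  KL-conj s Ns =
    let σ , σ∈KL , σeq = KL-left s (N⊆L Ns)
        ρ , ρ∈KL , ρeq = KL-right (s ⁻¹) (N⊆L (proj₂ (proj₂ (proj₁ N-minimal)) s Ns))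
    in σ ∘ₚ ρ , memL-∘ σ∈KL ρ∈KL , λ g → trans (ρeq _) (cong (_· (s ⁻¹)) (σeq g))

  E⇒quotient∈L : ∀ {x y} → E x y → L (y · (x ⁻¹))
  E⇒quotient∈L {x} {y} Exy =
    let ρ , ρ∈K , eq = right-translation (x ⁻¹)
    in E⇒L (subst₂ E (trans (eq x) (invʳ x)) (eq y) (E-map ρ∈K Exy))

  KL-transitive : ∀ {x y} → E x y → ∃ λ σ → memL σ × σ ⟨$⟩ʳ x ≡ y
  KL-transitive {x} {y} Exy =
    let σ , σ∈KL , eq = KL-left _ (E⇒quotient∈L Exy) in σ , σ∈KL , trans (eq x) (//-rightDividesˡ x y)

  E-nontrivial : ∀ p → Nontrivialₚ (E p) p
  E-nontrivial p =
    let a , Na , a≢e = proj₁ (proj₂ (proj₂ N-minimal))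
        σ , (_ , σE) , eq = KL-left a (N⊆L Na)
    in σ ⟨$⟩ʳ p , σE p , λ σp≡p → a≢e (begin
         a                     ≡⟨ //-rightDividesʳ p a ⟨
         (a · p) · (p ⁻¹)      ≡⟨ cong (_· (p ⁻¹)) (trans (sym (eq p)) σp≡p) ⟩
         p · (p ⁻¹)            ≡⟨ invʳ p ⟩
         e                     ∎)
    where open ≡-Reasoning

  -- Primitivity of K_𝔏 on the classes of 𝔏.

  -- The minimal blocks of KL form a K-invariant equivalence relation because KL is
  -- normal in K; being nontrivial by block⊇N, they are the blocks of 𝔏.
  A : Fin n → Fin n → Set
  A p = MinBlock KL (E p) p

  A⊆E : ∀ {p q} → A p q → E p q
  A⊆E {p} = MinBlock-least KL em (λ (_ , σE) _ _ Epy → E-trans Epy (σE _)) E-refl (E-nontrivial p) (λ Epy → Epy)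

  A-map : ∀ {τ p x} → mem τ → A p x → A (τ ⟨$⟩ʳ p) (τ ⟨$⟩ʳ x)
  A-map {τ} {p} τ∈K Apx B blk τp∈B (q , q∈B , q≢τp) B⊆E =
    MinBlock-least KL em pulled τp∈B
      (τ ⟨$⟩ˡ q , subst (_∈ B) (sym (inverseʳ τ)) q∈B , λ eq → q≢τp (trans (sym (inverseʳ τ)) (cong (τ ⟨$⟩ʳ_) eq)))
      (λ τy∈B → subst₂ E (inverseˡ τ) (inverseˡ τ) (E-map (mem-inv τ∈K) (B⊆E τy∈B))) Apx
    where
    pulled : Block KL (λ y → (τ ⟨$⟩ʳ y) ∈ B)
    pulled {σ} {x} {y} σ∈KL τx∈ τσx∈ τy∈ =
      subst (λ z → (τ ⟨$⟩ʳ (σ ⟨$⟩ʳ z)) ∈ B) (inverseˡ τ)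
        (blk (KL-normal τ∈K σ∈KL) τx∈ (subst (λ z → (τ ⟨$⟩ʳ (σ ⟨$⟩ʳ z)) ∈ B) (sym (inverseˡ τ)) τσx∈) τy∈)

  A-block : ∀ {p} → Block KL (A p)
  A-block = MinBlock-block KL

  A-refl : ∀ {p} → A p p
  A-refl = MinBlock-refl KL

  -- Choose `σ` in `KL` with σp = q. Its inverse maps `q` to `p`, both in `A p`, so it preserves
  -- `A p` and sends `p` into it; applying `σ` moves this relation to one between `q` and `p`.
  A-sym : ∀ {p q} → A p q → A q p
  A-sym {p} {q} Apq =
    let σ , σ∈KL , σp≡q = KL-transitive (A⊆E Apq)
        σ⁻¹q≡p = trans (cong (σ ⟨$⟩ˡ_) (sym σp≡q)) (inverseˡ σ)
        Apσ⁻¹p = A-block (memL-inv σ∈KL) Apq (subst (A p) (sym σ⁻¹q≡p) A-refl) A-refl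
    in subst₂ A σp≡q (inverseʳ σ) (A-map (proj₁ σ∈KL) Apσ⁻¹p)

  A-trans : ∀ {p q r} → A p q → A q r → A p r
  A-trans {p} {q} {r} Apq Aqr =
    let σ , σ∈KL , σp≡q = KL-transitive (A⊆E Apq)
        σ⁻¹q≡p = trans (cong (σ ⟨$⟩ˡ_) (sym σp≡q)) (inverseˡ σ)
        Apσ⁻¹r = subst (λ z → A z (σ ⟨$⟩ˡ r)) σ⁻¹q≡p (A-map (mem-inv (proj₁ σ∈KL)) Aqr)
    in subst (A p) (inverseʳ σ) (A-block σ∈KL A-refl (subst (A p) (sym σp≡q) Apq) Apσ⁻¹r)

  -- `A e` is a class of a `K`-invariant equivalence, hence a block of `K`, and it is nontrivial
  -- because it contains `N`; now `L` is minimal.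
  L⊆A : ∀ {x} → L x → A e x
  L⊆A = MinBlock-least K em Ae-block A-refl A-nontrivial (λ _ → tt)
    where
    Ae-block : Block K (A e)
    Ae-block σ∈K Ax Aσx Ay = A-trans Aσx (A-map σ∈K (A-trans (A-sym Ax) Ay))
    N⊆A : ∀ {s} → N s → A e s
    N⊆A Ns B blk e∈B nontrivial B⊆E =
      block⊇N KL blk e∈B nontrivial (λ b b∈B → KL-left b (E⇒L (B⊆E b∈B))) KL-conj Ns
    A-nontrivial : Nontrivialₚ (A e) e
    A-nontrivial = let a , Na , a≢e = proj₁ (proj₂ (proj₂ N-minimal)) in a , N⊆A Na , a≢e

  -- Right translation carries `L⊆A` from `e` to `p`, so `A p`, which every such block contains, is
  -- already the whole class.
  KL-primitive : ∀ {p B} → Block KL B → B p → Nontrivialₚ B p → (∀ {y} → B y → E p y) →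
    ∀ {q} → E p q → B q
  KL-primitive {p} blk Bp nontrivial B⊆E {q} Epq =
    let ρ , ρ∈K , eq = right-translation p
    in MinBlock-least KL em blk Bp nontrivial B⊆E
         (subst₂ A (trans (eq e) (idˡ p)) (trans (eq _) (//-rightDividesˡ p q))
           (A-map ρ∈K (L⊆A (E⇒quotient∈L Epq))))

  -- The relation ∼ between classes of 𝔏.

  FixesClass : Permutation′ n → Fin n → Set
  FixesClass σ p = ∀ x → E p x → σ ⟨$⟩ʳ x ≡ x

  -- For X and X' the classes of `p` and `q`, this is injectivity of the restriction from X ∪ X' to
  -- X, expressed as triviality of its kernel.
  R : Fin n → Fin n → Set
  R p q = ∀ σ → memL σ → FixesClass σ p → FixesClass σ q

  R-map : ∀ {τ p q} → mem τ → R p q → R (τ ⟨$⟩ʳ p) (τ ⟨$⟩ʳ q)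
  R-map {τ} {p} {q} τ∈K Rpq σ σ∈KL fix x Ex = begin
    σ ⟨$⟩ʳ x                                         ≡⟨ cong (σ ⟨$⟩ʳ_) (inverseʳ τ) ⟨
    σ ⟨$⟩ʳ (τ ⟨$⟩ʳ (τ ⟨$⟩ˡ x))                       ≡⟨ inverseʳ τ ⟨
    τ ⟨$⟩ʳ (τ ⟨$⟩ˡ (σ ⟨$⟩ʳ (τ ⟨$⟩ʳ (τ ⟨$⟩ˡ x))))     ≡⟨ cong (τ ⟨$⟩ʳ_) (fixq (τ ⟨$⟩ˡ x) Eqτ⁻¹x) ⟩
    τ ⟨$⟩ʳ (τ ⟨$⟩ˡ x)                                ≡⟨ inverseʳ τ ⟩
    x                                                ∎
    where
    open ≡-Reasoning
    fixp : FixesClass (conjₚ (flip τ) σ) p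
    fixp y Epy = trans (cong (τ ⟨$⟩ˡ_) (fix _ (E-map τ∈K Epy))) (inverseˡ τ)
    fixq : FixesClass (conjₚ (flip τ) σ) q
    fixq = Rpq _ (KL-normal (mem-inv τ∈K) σ∈KL) fixp
    Eqτ⁻¹x : E q (τ ⟨$⟩ˡ x)
    Eqτ⁻¹x = subst (λ z → E z _) (inverseˡ τ) (E-map (mem-inv τ∈K) Ex)

  R-E : ∀ {p q} → E p q → R p q
  R-E Epq σ _ fix x Eqx = fix x (E-trans Epq Eqx)

  R-trans : ∀ {p q r} → R p q → R q r → R p r
  R-trans Rpq Rqr σ σ∈KL = Rqr σ σ∈KL ∘ Rpq σ σ∈KL

  Sim : Fin n → Fin n → Set
  Sim p q = R p q × R q p

  Sim-sym : ∀ {p q} → Sim p q → Sim q p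
  Sim-sym (Rpq , Rqp) = Rqp , Rpq

  Sim-trans : ∀ {p q r} → Sim p q → Sim q r → Sim p r
  Sim-trans (Rpq , Rqp) (Rqr , Rrq) = R-trans Rpq Rqr , R-trans Rrq Rqp

  Sim-map : ∀ {τ p q} → mem τ → Sim p q → Sim (τ ⟨$⟩ʳ p) (τ ⟨$⟩ʳ q)
  Sim-map τ∈K (Rpq , Rqp) = R-map τ∈K Rpq , R-map τ∈K Rqp

  E⇒Sim : ∀ {p q} → E p q → Sim p q
  E⇒Sim Epq = R-E Epq , R-E (E-sym Epq)

  -- Pointwise stabilizers of classes.

  Fixator : Fin n → PermGroup n
  Fixator a = record
    { mem      = λ σ → memL σ × FixesClass σ a
    ; mem-resp = λ σ≈τ (σ∈KL , fix) → PermGroup.mem-resp KL σ≈τ σ∈KL , λ x Eax → trans (sym (σ≈τ x)) (fix x Eax)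
    ; mem-id   = PermGroup.mem-id KL , λ _ _ → refl
    ; mem-∘    = λ {_} {τ} (σ∈KL , fixσ) (τ∈KL , fixτ) →
        memL-∘ σ∈KL τ∈KL , λ x Eax → trans (cong (τ ⟨$⟩ʳ_) (fixσ x Eax)) (fixτ x Eax)
    ; mem-inv  = λ {σ} (σ∈KL , fix) →
        memL-inv σ∈KL , λ x Eax → trans (cong (σ ⟨$⟩ˡ_) (sym (fix x Eax))) (inverseˡ σ)
    }

  Fixator-normal : ∀ {a τ σ} → memL τ → PermGroup.mem (Fixator a) σ →
    PermGroup.mem (Fixator a) (conjₚ τ σ)
  Fixator-normal {a} {τ} {σ} τ∈KL (σ∈KL , fix) = KL-normal (proj₁ τ∈KL) σ∈KL , λ x Eax →
    trans (cong (τ ⟨$⟩ʳ_) (fix (τ ⟨$⟩ˡ x) (E-trans Eax (proj₂ (memL-inv τ∈KL) x)))) (inverseʳ τ)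

  Fixator-orbit : Fin n → Fin n → Fin n → Set
  Fixator-orbit a = SameOrbit (PermGroup.mem (Fixator a))

  -- The fixator is normal in `KL`, and orbits of a normal subgroup are blocks.
  Fixator-orbit-block : ∀ {a x} → Block KL (Fixator-orbit a x)
  Fixator-orbit-block {a} {x} {τ} τ∈KL (σ , σ∈F , σx≡y) (ρ , ρ∈F , ρx≡τy) (π , π∈F , πx≡z) =
    -- The witness takes x to τy by `ρ`, then back to y, to x by the inverse of `σ`, to z by `π`,
    -- and finally to τz.
    ρ ∘ₚ conjₚ τ (flip σ ∘ₚ π) ,
    mem-∘F ρ∈F (Fixator-normal τ∈KL (mem-∘F (PermGroup.mem-inv (Fixator a) σ∈F) π∈F)) ,
    cong (τ ⟨$⟩ʳ_) (trans (cong (π ⟨$⟩ʳ_) σ⁻¹τ⁻¹ρx≡x) πx≡z)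
    where
    open PermGroup (Fixator a) using () renaming (mem-∘ to mem-∘F)
    open ≡-Reasoning
    σ⁻¹τ⁻¹ρx≡x : σ ⟨$⟩ˡ (τ ⟨$⟩ˡ (ρ ⟨$⟩ʳ x)) ≡ x
    σ⁻¹τ⁻¹ρx≡x = begin
      σ ⟨$⟩ˡ (τ ⟨$⟩ˡ (ρ ⟨$⟩ʳ x))  ≡⟨ cong (λ w → σ ⟨$⟩ˡ (τ ⟨$⟩ˡ w)) ρx≡τy ⟩
      σ ⟨$⟩ˡ (τ ⟨$⟩ˡ (τ ⟨$⟩ʳ _))  ≡⟨ cong (σ ⟨$⟩ˡ_) (inverseˡ τ) ⟩
      σ ⟨$⟩ˡ _                    ≡⟨ cong (σ ⟨$⟩ˡ_) (sym σx≡y) ⟩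
      σ ⟨$⟩ˡ (σ ⟨$⟩ʳ x)           ≡⟨ inverseˡ σ ⟩
      x                           ∎

  -- Failure of `R a b` yields a point in the class of `b` moved by the fixator of `a`. Its orbit is
  -- then a nontrivial block of `KL`, and primitivity makes it the whole class.
  Fixator-transitive : ∀ {a b} → ¬ R a b → ∀ {y z} → E b y → E b z → Fixator-orbit a y z
  Fixator-transitive {a} {b} ¬Rab {y} {z} Eby Ebz =
    let σ , σ∈F , σx≡y = orbit⊇ Eby
        ρ , ρ∈F , ρx≡z = orbit⊇ Ebz
    in flip σ ∘ₚ ρ , PermGroup.mem-∘ (Fixator a) (PermGroup.mem-inv (Fixator a) σ∈F) ρ∈F ,
       trans (cong (ρ ⟨$⟩ʳ_) (trans (cong (σ ⟨$⟩ˡ_) (sym σx≡y)) (inverseˡ σ))) ρx≡z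
    where
    moved : ∃ λ x → E b x × ∃ λ σ → PermGroup.mem (Fixator a) σ × σ ⟨$⟩ʳ x ≢ x
    moved = decidable-stable em λ none → ¬Rab λ σ σ∈KL fix x Ebx →
      decidable-stable (_ ≟ x) λ σx≢x → none (x , Ebx , σ , (σ∈KL , fix) , σx≢x)
    x : Fin n
    x = proj₁ moved
    orbit⊇ : ∀ {y} → E b y → Fixator-orbit a x y
    orbit⊇ Eby =
      let _ , Ebx , σ , σ∈F , σx≢x = moved
      in KL-primitive Fixator-orbit-block (idₚ , PermGroup.mem-id (Fixator a) , refl)
           (σ ⟨$⟩ʳ x , (σ , σ∈F , refl) , σx≢x)
           (λ (ρ , ρ∈F , ρx≡y) → subst (E x) ρx≡y (proj₂ (proj₁ ρ∈F) x))
           (E-trans (E-sym Ebx) Eby)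

  -- Independence of orbits and the product decomposition.

  -- If `R a b` fails, let `σ` be followed by an element fixing the class of `a` pointwise: `c` lies
  -- in that class and stays put, while the image of `b` can be moved to `d` within the class of
  -- `b`. If `R a b` holds, then `R b a` fails and the roles are exchanged.
  separate-orbits : ∀ {a b c d} → ¬ Sim a b → SameOrbit memL a c → SameOrbit memL b d →
    SameOrbit₂ memL a b c d
  separate-orbits {a} {b} {c} {d} ¬sim (σ , σ∈KL , σa≡c) (ρ , ρ∈KL , ρb≡d) with em {R a b}
  ... | no ¬Rab =
    let ν , (ν∈KL , fix) , νσb≡d = Fixator-transitive ¬Rab (proj₂ σ∈KL b) (subst (E b) ρb≡d (proj₂ ρ∈KL b))
    in σ ∘ₚ ν , memL-∘ σ∈KL ν∈KL , trans (fix (σ ⟨$⟩ʳ a) (proj₂ σ∈KL a)) σa≡c , νσb≡d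
  ... | yes Rab =
    let ν , (ν∈KL , fix) , νρa≡c =
          Fixator-transitive (λ Rba → ¬sim (Rab , Rba)) (proj₂ ρ∈KL a) (subst (E a) σa≡c (proj₂ σ∈KL a))
    in ρ ∘ₚ ν , memL-∘ ρ∈KL ν∈KL , νρa≡c , trans (fix (ρ ⟨$⟩ʳ b) (proj₂ ρ∈KL b)) ρb≡d

  -- By 2-closedness it suffices to imitate `σ` on each pair by an element of `K`. Equivalent points
  -- share one local representative; for inequivalent points `separate-orbits` merges two of them.
  product⊆KL : ∀ σ → (∀ p → ∃ λ ρ → memL ρ × (∀ x → Sim x p → σ ⟨$⟩ʳ x ≡ ρ ⟨$⟩ʳ x)) → memL σ
  product⊆KL σ local = closed σ preserved , λ x →
    let ρ , (_ , ρE) , eq = local x in subst (E x) (sym (eq x (E⇒Sim E-refl))) (ρE x)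
    where
    preserved : ∀ a b → SameOrbit₂ mem a b (σ ⟨$⟩ʳ a) (σ ⟨$⟩ʳ b)
    preserved a b with em {Sim a b} | local b
    ... | yes sim | ρ , ρ∈KL , eq = ρ , proj₁ ρ∈KL , sym (eq a sim) , sym (eq b (E⇒Sim E-refl))
    ... | no ¬sim | ρ , ρ∈KL , eq =
      let π , π∈KL , eq′ = local a
          ν , ν∈KL , νa , νb = separate-orbits ¬sim
            (π , π∈KL , sym (eq′ a (E⇒Sim E-refl))) (ρ , ρ∈KL , sym (eq b (E⇒Sim E-refl)))
      in ν , proj₁ ν∈KL , νa , νb

  -- Agreement with the definitions of the principal section.

  L⇔ : ∀ {x} → P.L x ⇔ L x
  L⇔ {x} = mk⇔ to from
    where
    to : P.L x → L x
    to Lx B blk e∈B (q , q∈B , q≢e) _ = Lx (_∈ B) isBlock e∈B (q , e , q∈B , e∈B , q≢e)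
      where
      isBlock : P.IsBlock (_∈ B)
      isBlock σ σ∈K with em {∃ λ z → z ∈ B × (σ ⟨$⟩ʳ z) ∈ B}
      ... | no disjoint = inj₂ λ z z∈ σz∈ → disjoint (z , z∈ , σz∈)
      ... | yes (z , z∈ , σz∈) = inj₁ λ y → blk σ∈K z∈ σz∈ , λ σy∈ → subst (_∈ B) (inverseˡ σ)
        (blk (mem-inv σ∈K) σz∈ (subst (_∈ B) (sym (inverseˡ σ)) z∈) σy∈)
    from : L x → P.L x
    from Lx B isBlock Be (a , b , Ba , Bb , a≢b) = MinBlock-least K em block Be nontrivial (λ _ → tt) Lx
      where
      block : Block K B
      block {σ} {z} {y} σ∈K Bz Bσz By with isBlock σ σ∈K
      ... | inj₁ stable   = proj₁ (stable y) By
      ... | inj₂ disjoint = contradiction Bσz (disjoint z Bz)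
      -- Of two distinct points of `B`, at least one differs from `e`.
      nontrivial : Nontrivialₚ B e
      nontrivial with a ≟ e
      ... | no a≢e   = a , Ba , a≢e
      ... | yes refl = b , Bb , a≢b ∘ sym

  open Equivalence using (to; from)

  InLBlock⇔ : ∀ {τ x} → mem τ → P.InLBlock τ x ⇔ E (τ ⟨$⟩ʳ e) x
  InLBlock⇔ τ∈K = mk⇔ (τL⇒E τ∈K ∘ to L⇔) (from L⇔ ∘ E⇒τL τ∈K)

  KL⇔ : ∀ {σ} → P.KL σ ⇔ memL σ
  KL⇔ {σ} = mk⇔ ⇒ ⇐
    where
    ⇒ : P.KL σ → memL σ
    ⇒ (σ∈K , stable) = σ∈K , λ x →
      let τ , τ∈K , τe≡x = transitive x
      in subst (λ z → E z _) τe≡x (to (InLBlock⇔ τ∈K) (proj₁ (stable τ τ∈K x)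
           (from (InLBlock⇔ τ∈K) (subst (λ z → E z x) (sym τe≡x) E-refl))))
    ⇐ : memL σ → P.KL σ
    ⇐ (σ∈K , σE) = σ∈K , λ τ τ∈K x →
      (λ x∈ → from (InLBlock⇔ τ∈K) (E-trans (to (InLBlock⇔ τ∈K) x∈) (σE x))) ,
      (λ σx∈ → from (InLBlock⇔ τ∈K) (E-trans (to (InLBlock⇔ τ∈K) σx∈) (E-sym (σE x))))

  -- Two elements agree on a class exactly when their quotient fixes it pointwise, which reduces
  -- injectivity to the kernel condition; conversely, the kernel condition is injectivity tested
  -- against the identity.
  RestrictInj⇔ : ∀ {τ τ′} → mem τ → mem τ′ → P.RestrictInj τ τ′ ⇔ R (τ ⟨$⟩ʳ e) (τ′ ⟨$⟩ʳ e)
  RestrictInj⇔ {τ} {τ′} τ∈K τ′∈K = mk⇔ ⇒ ⇐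
    where
    ⇒ : P.RestrictInj τ τ′ → R (τ ⟨$⟩ʳ e) (τ′ ⟨$⟩ʳ e)
    ⇒ inj σ σ∈KL fix x Ex = inj σ idₚ (from KL⇔ σ∈KL) (from KL⇔ (PermGroup.mem-id KL))
      (λ y y∈ → fix y (to (InLBlock⇔ τ∈K) y∈)) x (from (InLBlock⇔ τ′∈K) Ex)
    ⇐ : R (τ ⟨$⟩ʳ e) (τ′ ⟨$⟩ʳ e) → P.RestrictInj τ τ′
    ⇐ Rττ′ σ ρ σ∈KL ρ∈KL agree x x∈ = trans (sym (inverseʳ ρ)) (cong (ρ ⟨$⟩ʳ_)
      (Rττ′ (σ ∘ₚ flip ρ) (memL-∘ (to KL⇔ σ∈KL) (memL-inv (to KL⇔ ρ∈KL)))
        (λ y Ey → trans (cong (ρ ⟨$⟩ˡ_) (agree y (from (InLBlock⇔ τ∈K) Ey))) (inverseˡ ρ))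
        x (to (InLBlock⇔ τ′∈K) x∈)))

  U⇔ : ∀ {x} → P.U x ⇔ Sim x e
  U⇔ {x} = mk⇔
    (λ (τ , τ∈K , x∈ , inj , inj′) → Sim-trans (Sim-sym (E⇒Sim (to (InLBlock⇔ τ∈K) x∈)))
      (to (RestrictInj⇔ τ∈K mem-id) inj , to (RestrictInj⇔ mem-id τ∈K) inj′))
    ⇐
    where
    ⇐ : Sim x e → P.U x
    ⇐ sim = let τ , τ∈K , τe≡x = transitive x
                Rτe , Reτ = subst (λ z → Sim z e) (sym τe≡x) sim
            in τ , τ∈K , from (InLBlock⇔ τ∈K) (subst (E _) τe≡x E-refl) ,
               from (RestrictInj⇔ τ∈K mem-id) Rτe , from (RestrictInj⇔ mem-id τ∈K) Reτ

  InUBlock⇔ : ∀ {τ x} → mem τ → P.InUBlock τ x ⇔ Sim x (τ ⟨$⟩ʳ e)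
  InUBlock⇔ {τ} {x} τ∈K = mk⇔
    (λ x∈ → subst (λ z → Sim z _) (inverseʳ τ) (Sim-map τ∈K (to U⇔ x∈)))
    (λ sim → from U⇔ (subst (Sim _) (inverseˡ τ) (Sim-map (mem-inv τ∈K) sim)))

  -- Applied in contrapositive form: points sharing no block of 𝔘 satisfy the hypothesis of
  -- `separate-orbits`.
  Sim⇒SameU : ∀ {a b} → Sim a b → P.SameU a b
  Sim⇒SameU {a} {b} sim =
    let τ , τ∈K , τe≡b = transitive b
    in τ , τ∈K , from (InUBlock⇔ τ∈K) (subst (Sim a) (sym τe≡b) sim) ,
       from (InUBlock⇔ τ∈K) (subst (Sim b) (sym τe≡b) (E⇒Sim E-refl))

  -- The direct sum and the generalized wreath product.

  conclusion : P.Conclusion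
  conclusion = within , across , refines , λ σ → KL⊆product σ , product⊆ σ
    where
    -- Blocks of 𝔘 are unions of classes of 𝔏, and `KL` moves points only inside such classes.
    stays : ∀ {τ σ x} → mem τ → memL σ → P.InUBlock τ x → P.InUBlock τ (σ ⟨$⟩ʳ x)
    stays τ∈K (_ , σE) x∈ =
      from (InUBlock⇔ τ∈K) (Sim-trans (E⇒Sim (E-sym (σE _))) (to (InUBlock⇔ τ∈K) x∈))
    within : ∀ a b → P.SameU a b → ∀ c d → SameOrbit₂ P.KL a b c d →
      ∃ λ τ → mem τ × P.InUBlock τ a × P.InUBlock τ b × P.InUBlock τ c × P.InUBlock τ d
    within a b (τ , τ∈K , a∈ , b∈) _ _ (σ , σ∈KL , refl , refl) =
      τ , τ∈K , a∈ , b∈ , stays τ∈K (to KL⇔ σ∈KL) a∈ , stays τ∈K (to KL⇔ σ∈KL) b∈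
    across : ∀ a b → ¬ P.SameU a b → ∀ c d →
      (SameOrbit₂ P.KL a b c d → SameOrbit P.KL a c × SameOrbit P.KL b d) ×
      (SameOrbit P.KL a c × SameOrbit P.KL b d → SameOrbit₂ P.KL a b c d)
    across a b ¬sameU c d =
      (λ (σ , σ∈KL , σa , σb) → (σ , σ∈KL , σa) , (σ , σ∈KL , σb)) ,
      λ ((σ , σ∈KL , σa) , (ρ , ρ∈KL , ρb)) →
        let ν , ν∈KL , eqs = separate-orbits (¬sameU ∘ Sim⇒SameU) (σ , to KL⇔ σ∈KL , σa) (ρ , to KL⇔ ρ∈KL , ρb)
        in ν , from KL⇔ ν∈KL , eqs
    refines : ∀ τ → mem τ → ∃ λ τ′ → mem τ′ × (∀ x → P.InLBlock τ x → P.InUBlock τ′ x)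
    refines τ τ∈K = τ , τ∈K , λ x x∈ → from (InUBlock⇔ τ∈K) (E⇒Sim (E-sym (to (InLBlock⇔ τ∈K) x∈)))
    KL⊆product : ∀ σ → P.KL σ → P.InProduct σ
    KL⊆product σ σ∈KL τ τ∈K = σ , σ∈KL , λ _ _ → refl
    product⊆ : ∀ σ → P.InProduct σ → P.KL σ
    product⊆ σ local = from KL⇔ (product⊆KL σ λ p →
      -- The block of 𝔘 through `p` is τU for any `τ` in `K` taking `e` to `p`, so the local data at
      -- `τ` serve for `p`.
      let τ , τ∈K , τe≡p = transitive p
          ρ , ρ∈KL , eq = local τ τ∈K
      in ρ , to KL⇔ ρ∈KL , λ x sim → eq x (from (InUBlock⇔ τ∈K) (subst (Sim x) (sym τe≡p) sim)))

theorem4p4 : ∀ {n : ℕ} (G : FinGroup n) (K : PermGroup n) →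
    GroupNotions.AlmostSimple G → ContainsGStar G K → TwoClosed K →
    PrincipalSection.Conclusion G K
theorem4p4 = GeneralizedWreath.conclusion
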